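{- For every integer $t$, there is a function $f_t: \mathbb{N} \to \mathbb{N}$ such that for every digraph $D$ which is $t$-chordal and has no induced directed path with exactly $t$ vertices, we have $\vec{\chi}(D) \le f_t(\omega(D))$.
   Context: All digraphs are finite and simple: no loops, no parallel edges, and for two vertices $u,v$ not both of $uv$ and $vu$ are edges. A digraph is acyclic if it has no directed cycle. A $k$-dicoloring of a digraph $D$ is a function $f: V(D) \to \{1,\dots,k\}$ such that each color class $f^{ -1}(i)$ induces an acyclic subdigraph. The dichromatic number $\vec{\chi}(D)$ is the minimum $k$ for which a $k$-dicoloring exists. $\omega(D)$ is the clique number of the underlying undirected graph of $D$. A digraph is $t$-chordal if every induced directed cycle in it has length exactly $t$. An induced directed path is a directed path $v_1 \to v_2 \to \dots \to v_m$ whose vertex set induces exactly the edges $v_iv_{i+1}$, $1 \le i < m$. -}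

module Defs where

open import Data.Nat using (ℕ; zero; suc; _≤_; NonZero)
open import Data.Nat.DivMod using (_mod_)
open import Data.Fin using (Fin; toℕ)
open import Data.Bool using (Bool; true; false)
open import Data.Integer using (ℤ; +_)
open import Data.Product using (Σ; _×_; _,_)
open import Data.Sum using (_⊎_)
open import Relation.Nullary using (¬_)
open import Relation.Binary.PropositionalEquality using (_≡_; _≢_)
open import Function.Definitions using (Injective)

record Digraph : Set where
  field
    n        : ℕ
    arc      : Fin n → Fin n → Bool
    loopless : ∀ v → arc v v ≡ false
    asym     : ∀ u v → arc u v ≡ true → arc v u ≡ false
open Digraph public

next : ∀ {m} → Fin (suc m) → Fin (suc m)
next {m} i = suc (toℕ i) mod suc m

record DirectedCycle (D : Digraph) (m : ℕ) : Set where
  field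
    vtx      : Fin (suc m) → Fin (n D)
    len≥2    : 1 ≤ m
    distinct : Injective _≡_ _≡_ vtx
    arcs     : ∀ i → arc D (vtx i) (vtx (next i)) ≡ true
open DirectedCycle public

InducedCycle : (D : Digraph) (m : ℕ) → DirectedCycle D m → Set
InducedCycle D m C = ∀ i j → arc D (vtx C i) (vtx C j) ≡ true → j ≡ next i

-- D is t-chordal: every induced directed cycle has length exactly t
-- (the length of a DirectedCycle D m is suc m).
TChordal : ℤ → Digraph → Set
TChordal t D = ∀ m (C : DirectedCycle D m) → InducedCycle D m C → + (suc m) ≡ t

record InducedPath (D : Digraph) (k : ℕ) : Set where
  field
    pv       : Fin k → Fin (n D)
    distinct : Injective _≡_ _≡_ pv
    arcs     : ∀ i j → toℕ j ≡ suc (toℕ i) → arc D (pv i) (pv j) ≡ true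
    induced  : ∀ i j → arc D (pv i) (pv j) ≡ true → toℕ j ≡ suc (toℕ i)

HasInducedPath : ℤ → Digraph → Set
HasInducedPath t D = Σ ℕ λ k → (t ≡ + k) × InducedPath D k

Clique : (D : Digraph) → ℕ → Set
Clique D w = Σ (Fin w → Fin (n D)) λ c →
  Injective _≡_ _≡_ c ×
  (∀ i j → i ≢ j → (arc D (c i) (c j) ≡ true) ⊎ (arc D (c j) (c i) ≡ true))

CliqueNumber : Digraph → ℕ → Set
CliqueNumber D w = Clique D w × (∀ k → Clique D k → k ≤ w)

IsDicoloring : (D : Digraph) (k : ℕ) → (Fin (n D) → Fin k) → Set
IsDicoloring D k col = ∀ (a : Fin k) m (C : DirectedCycle D m) →
  ¬ (∀ i → col (vtx C i) ≡ a)

-- χ⃗(D) ≤ k  ⇔  D admits a k-dicoloring.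
Dicolorable : Digraph → ℕ → Set
Dicolorable D k = Σ (Fin (n D) → Fin k) λ col → IsDicoloring D k col

-- A shortest closed walk is an induced cycle, so every closed walk has length at least t.
-- Pick a vertex u. Let Q⁺ be the set of vertices reachable from u by walks that avoid
-- N⁻(u) and do not return to u, and let Q⁻ be its dual; then N⁻(u) ⊆ Q⁻ and N⁺(u) ⊆ Q⁺,
-- so an arc between {u} ∪ Q⁺ ∪ Q⁻ and the rest neither leaves {u} ∪ Q⁺ nor enters Q⁻.
-- Hence, if {u} ∪ Q⁺ and Q⁻ get disjoint palettes, the rest may be coloured independently.
-- To colour Q⁻, grow a directed path p₀ → p₁ → … → u at its front, together with a set Q
-- of vertices that all reach p₀ inside Q, have no arc to p₁, …, u and receive none from u.
-- The in-neighbours of p₀ in Q have smaller clique number; the other vertices of Q reach p₀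
-- through such an in-neighbour q and are handled by prepending q. On t vertices the only
-- backward arc not closing a walk shorter than t would go from u to p₀; it is excluded, so
-- the path would be induced, and therefore Q is empty one vertex earlier.
module Submission where

open import Defs
open import Data.Nat using (ℕ; zero; suc; _+_; _∸_; _≤_; _<_; z≤n; s≤s)
open import Data.Nat.Properties using (≤-refl; ≤-trans; ≤-antisym; ≤-reflexive; <-cmp; <⇒≤;
  <-irrefl; +-comm; +-suc; m∸n≤m; m<n⇒0<n∸m; m∸n+n≡m; ≤-<-trans; suc-injective; ≤-pred; +-monoʳ-≤;
  1+n≰n)
open import Data.Nat.DivMod using (_%_; m<n⇒m%n≡m; n%n≡0)
open import Data.Nat.Induction using (<-rec)
open import Data.Bool using (true; if_then_else_)
import Data.Bool.Properties as Bool
open import Data.Integer as ℤ using (ℤ; -[1+_])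
import Data.Integer.Properties as ℤ
open import Data.Fin using (Fin; zero; suc; toℕ; fromℕ; fromℕ<; opposite; _↑ˡ_; _↑ʳ_; splitAt)
open import Data.Fin.Properties using (_≟_; any?; toℕ<n; toℕ-injective; toℕ-fromℕ; toℕ-fromℕ<;
  opposite-prop; opposite-involutive; ↑ˡ-injective; ↑ʳ-injective; splitAt-↑ˡ; splitAt-↑ʳ)
open import Data.Fin.Subset using (Subset; _∈_; _∉_; _⊆_; _⊂_; _⊃_; _∪_; ⁅_⁆; ⊤; ⊥)
open import Data.Fin.Subset.Properties using (_∈?_; nonempty?; p⊆p∪q; q⊆p∪q; x∈p∪q⁻; x∈⁅x⁆;
  x∈⁅y⁆⇒x≡y; ∈⊤; ∉⊥)
open import Data.Fin.Subset.Induction using (⊂-wellFounded; ⊃-wellFounded; Acc; acc)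
open import Data.Vec using (tabulate)
open import Data.Vec.Properties using (lookup⇒[]=; []=⇒lookup; lookup∘tabulate)
open import Data.Vec.Functional using (Vector; _∷_)
open import Data.Product using (Σ; Σ-syntax; ∃; _×_; _,_; proj₁; proj₂)
open import Data.Sum using (_⊎_; inj₁; inj₂; [_,_]′; swap)
open import Data.Empty using (⊥-elim)
open import Function using (flip; _∘_; id)
open import Relation.Binary using (Decidable; tri<; tri≈; tri>)
open import Relation.Binary.PropositionalEquality using (_≡_; _≢_; refl; sym; trans; cong; subst;
  subst₂)
open import Relation.Nullary using (¬_; yes; no; does; contradiction)
open import Relation.Nullary.Decidable using (_×-dec_; _⊎-dec_; ¬?; dec-true; decidable-stable)
import Relation.Unary as U

-- Walks in a relation

private
  variable
    A : Set
    R S : A → A → Set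
    N k l : ℕ

data Walk {A : Set} (R : A → A → Set) : A → ℕ → A → Set where
  ε   : ∀ {a} → Walk R a 0 a
  _◅_ : ∀ {a b c} → R a b → Walk R b k c → Walk R a (suc k) c

infixr 5 _◅_ _◅◅_

_◅◅_ : ∀ {a b c} → Walk R a k b → Walk R b l c → Walk R a (k + l) c
ε       ◅◅ v = v
(r ◅ w) ◅◅ v = r ◅ (w ◅◅ v)

walk-map : (∀ a b → R a b → S a b) → ∀ {a b} → Walk R a k b → Walk S a k b
walk-map f ε       = ε
walk-map f (r ◅ w) = f _ _ r ◅ walk-map f w

walk-reverse : ∀ {R : A → A → Set} {a b} → Walk R a k b → Walk (flip R) b k a
walk-reverse ε = ε
walk-reverse {k = suc k} {R = R} {a} {b} (r ◅ w) =
  subst (λ l → Walk (flip R) b l a) (+-comm k 1) (walk-reverse w ◅◅ (r ◅ ε))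

Consecutive : (A → A → Set) → Vector A k → Set
Consecutive R p = ∀ i j → toℕ j ≡ suc (toℕ i) → R (p i) (p j)

segment : (p : Vector A k) → Consecutive R p →
          ∀ i j → toℕ i ≤ toℕ j → Walk R (p i) (toℕ j ∸ toℕ i) (p j)
segment p c zero zero _ = ε
segment {k = suc (suc _)} p c zero (suc j) _ =
  c zero (suc zero) refl ◅ segment (p ∘ suc) (λ i j e → c (suc i) (suc j) (cong suc e)) zero j z≤n
segment p c (suc i) (suc j) (s≤s i≤j) =
  segment (p ∘ suc) (λ i j e → c (suc i) (suc j) (cong suc e)) i j i≤j

-- Leaving out the final vertex turns a closed walk with `k` arcs into a cyclic list of `k` entries.
sources : ∀ {R : A → A → Set} {a b} → Walk R a k b → Vector A k
sources {a = a} (r ◅ w) zero    = a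
sources         (r ◅ w) (suc i) = sources w i

sources-consecutive : ∀ {a b} (w : Walk R a k b) → Consecutive R (sources w)
sources-consecutive (r ◅ (_ ◅ w)) zero (suc zero) e = r
sources-consecutive (r ◅ w@(_ ◅ _)) zero (suc (suc j)) ()
sources-consecutive (r ◅ w) (suc i) (suc j) e = sources-consecutive w i j (suc-injective e)

sources-last : ∀ {a b} (w : Walk R a (suc k) b) → R (sources w (fromℕ k)) b
sources-last (r ◅ ε)           = r
sources-last (r ◅ w@(_ ◅ _)) = sources-last w

-- Acyclicity by ranks

Acyclic : (A → A → Set) → Set
Acyclic R = ∀ {a k} → ¬ Walk R a (suc k) a

Level : (A → A → Set) → (A → ℕ) → ℕ → A → A → Set
Level R rank r a b = R a b × rank a ≡ r × rank b ≡ r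

module _ {A : Set} {R : A → A → Set} (rank : A → ℕ)
         (antitone : ∀ a b → R a b → rank b ≤ rank a) where

  walk-antitone : ∀ {a b} → Walk R a k b → rank b ≤ rank a
  walk-antitone ε       = ≤-refl
  walk-antitone (r ◅ w) = ≤-trans (walk-antitone w) (antitone _ _ r)

  level-walk : ∀ {a b r} → Walk R a k b → rank a ≡ r → r ≤ rank b → Walk (Level R rank r) a k b
  level-walk ε       _    _   = ε
  level-walk (s ◅ w) refl r≤b = (s , refl , eq) ◅ level-walk w eq r≤b
    where eq = ≤-antisym (antitone _ _ s) (≤-trans r≤b (walk-antitone w))

  -- Along a closed walk the rank never rises and finally regains its first value, so it is constant
  -- and the walk stays in one level.
  acyclic-by-rank : (∀ r → Acyclic (Level R rank r)) → Acyclic R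
  acyclic-by-rank levels w = levels _ (level-walk w refl ≤-refl)

-- Subsets by comprehension

module _ {P : Fin N → Set} (P? : U.Decidable P) where

  comprehension : Subset N
  comprehension = tabulate (does ∘ P?)

  ∈-comprehension⁺ : ∀ {x} → P x → x ∈ comprehension
  ∈-comprehension⁺ {x} px =
    lookup⇒[]= x _ (trans (lookup∘tabulate _ x) (dec-true (P? x) px))

  ∈-comprehension⁻ : ∀ {x} → x ∈ comprehension → P x
  ∈-comprehension⁻ {x} x∈ with P? x | trans (sym (lookup∘tabulate (does ∘ P?) x)) ([]=⇒lookup x∈)
  ... | yes px | _ = px

_∖_ : Subset N → Subset N → Subset N
Y ∖ Z = comprehension (λ x → x ∈? Y ×-dec ¬? (x ∈? Z))

∈-∖⁺ : ∀ {Y Z : Subset N} {x} → x ∈ Y → x ∉ Z → x ∈ Y ∖ Z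
∈-∖⁺ {Y = Y} {Z} x∈Y x∉Z = ∈-comprehension⁺ (λ x → x ∈? Y ×-dec ¬? (x ∈? Z)) (x∈Y , x∉Z)

∈-∖⁻ : ∀ (Y Z : Subset N) {x} → x ∈ Y ∖ Z → x ∈ Y × x ∉ Z
∈-∖⁻ Y Z = ∈-comprehension⁻ (λ x → x ∈? Y ×-dec ¬? (x ∈? Z))

∖-⊂ : ∀ {Y Z : Subset N} {x} → x ∈ Y → x ∈ Z → Y ∖ Z ⊂ Y
∖-⊂ {Y = Y} {Z} x∈Y x∈Z = proj₁ ∘ ∈-∖⁻ Y Z , _ , x∈Y , λ x∈ → proj₂ (∈-∖⁻ Y Z x∈) x∈Z

-- Colourings and their combination

Mono : (Fin N → Fin N → Set) → Subset N → (Fin N → Fin k) → Fin N → Fin N → Set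
Mono E Y col a b = a ∈ Y × b ∈ Y × E a b × col a ≡ col b

Colourable : (Fin N → Fin N → Set) → Subset N → ℕ → Set
Colourable {N} E Y k = Σ[ col ∈ (Fin N → Fin k) ] Acyclic (Mono E Y col)

colourable-⊆ : ∀ {E : Fin N → Fin N → Set} {X Y} → X ⊆ Y → Colourable E Y k → Colourable E X k
colourable-⊆ X⊆Y (col , acyclic) =
  col , acyclic ∘ walk-map λ _ _ (a∈ , b∈ , e , eq) → X⊆Y a∈ , X⊆Y b∈ , e , eq

colourable-flip : ∀ {E : Fin N → Fin N → Set} {Y} → Colourable (flip E) Y k → Colourable E Y k
colourable-flip (col , acyclic) =
  col , λ w → acyclic (walk-map (λ _ _ (a∈ , b∈ , e , eq) → b∈ , a∈ , e , sym eq) (walk-reverse w))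

arcless-acyclic : ∀ {R : A → A → Set} → (∀ a b → ¬ R a b) → Acyclic R
arcless-acyclic ¬r (r ◅ _) = ¬r _ _ r

colourable-empty : ∀ {E : Fin N → Fin N → Set} {Y} → (∀ {x} → x ∉ Y) → Colourable E Y (suc k)
colourable-empty empty = (λ _ → zero) , arcless-acyclic λ _ _ (a∈ , _) → empty a∈

module _ {E : Fin N → Fin N → Set} where

  -- A walk in `Y` that has left `Z` cannot come back, so a closed walk lies wholly inside or wholly
  -- outside `Z`, and one palette serves both parts.
  colourable-∖-closed : ∀ {Y Z} → (∀ {a b} → b ∈ Z → a ∈ Y → E a b → a ∈ Z) →
    Colourable E Z k → Colourable E (Y ∖ Z) k → Colourable E Y k
  colourable-∖-closed {k = k} {Y} {Z} closed (cZ , acyclicZ) (cW , acyclicW) =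
    col , acyclic-by-rank rank antitone levels
    where
    col : Fin N → Fin k
    col v = if does (v ∈? Z) then cZ v else cW v
    rank : Fin N → ℕ
    rank v = if does (v ∈? Z) then 1 else 0

    antitone : ∀ a b → Mono E Y col a b → rank b ≤ rank a
    antitone a b (a∈ , b∈ , e , _) with b ∈? Z | a ∈? Z
    ... | no  _   | _      = z≤n
    ... | yes _   | yes _  = ≤-refl
    ... | yes b∈Z | no a∉Z = contradiction (closed b∈Z a∈ e) a∉Z

    level₀ : ∀ a b → Level (Mono E Y col) rank 0 a b → Mono E (Y ∖ Z) cW a b
    level₀ a b s with a ∈? Z | b ∈? Z
    level₀ a b ((a∈ , b∈ , e , eq) , _ , _) | no a∉ | no b∉ = ∈-∖⁺ a∈ a∉ , ∈-∖⁺ b∈ b∉ , e , eq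
    level₀ a b (_ , () , _) | yes _ | _
    level₀ a b (_ , _ , ()) | no _ | yes _

    level₁ : ∀ a b → Level (Mono E Y col) rank 1 a b → Mono E Z cZ a b
    level₁ a b s with a ∈? Z | b ∈? Z
    level₁ a b ((_ , _ , e , eq) , _ , _) | yes a∈ | yes b∈ = a∈ , b∈ , e , eq
    level₁ a b (_ , () , _) | no _ | _
    level₁ a b (_ , _ , ()) | yes _ | no _

    level₂ : ∀ r a b → ¬ Level (Mono E Y col) rank (suc (suc r)) a b
    level₂ r a b s with a ∈? Z
    level₂ r a b (_ , () , _) | yes _
    level₂ r a b (_ , () , _) | no _

    levels : ∀ r → Acyclic (Level (Mono E Y col) rank r)
    levels 0             = acyclicW ∘ walk-map level₀
    levels 1             = acyclicZ ∘ walk-map level₁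
    levels (suc (suc r)) = arcless-acyclic (level₂ r)

  -- `A` and `B` get disjoint palettes, with `A` taking precedence on the overlap; the rest uses
  -- both palettes. A monochromatic arc cannot leave `A`, since it could only go to `B`, where the
  -- colours differ. Dually, none enters `B` from outside. Hence the ranks 0 on `A`, 1 on the rest
  -- and 2 on `B` never rise along such arcs.
  colourable-dipolar : ∀ {Y A B} →
    (∀ {a b} → a ∈ A → b ∈ Y → E a b → b ∈ A ⊎ b ∈ B) →
    (∀ {a b} → b ∈ B → a ∈ Y → E a b → a ∈ A ⊎ a ∈ B) →
    Colourable E A k → Colourable E B l → Colourable E ((Y ∖ A) ∖ B) (k + l) →
    Colourable E Y (k + l)
  colourable-dipolar {k = k} {l} {Y} {A} {B} outA inB (cA , acyclicA) (cB , acyclicB) (cW , acyclicW) =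
    col , acyclic-by-rank rank antitone levels
    where
    col : Fin N → Fin (k + l)
    col v = if does (v ∈? A) then cA v ↑ˡ l else if does (v ∈? B) then k ↑ʳ cB v else cW v
    rank : Fin N → ℕ
    rank v = if does (v ∈? A) then 0 else if does (v ∈? B) then 2 else 1

    ↑ˡ≢↑ʳ : ∀ {i : Fin k} {j : Fin l} → i ↑ˡ l ≢ k ↑ʳ j
    ↑ˡ≢↑ʳ {i} {j} eq with trans (sym (splitAt-↑ˡ k i l)) (trans (cong (splitAt k) eq) (splitAt-↑ʳ k l j))
    ... | ()

    antitone : ∀ a b → Mono E Y col a b → rank b ≤ rank a
    antitone a b s with a ∈? A | a ∈? B | b ∈? A | b ∈? B
    antitone a b s | _ | _ | yes _ | _ = z≤n
    antitone a b (_ , b∈ , e , _) | yes a∈A | _ | no b∉A | no b∉B =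
      contradiction (outA a∈A b∈ e) [ b∉A , b∉B ]′
    antitone a b (_ , _ , _ , eq) | yes _ | _ | no _ | yes _ = contradiction eq ↑ˡ≢↑ʳ
    antitone a b s | no _ | yes _ | no _ | yes _ = ≤-refl
    antitone a b s | no _ | yes _ | no _ | no _ = s≤s z≤n
    antitone a b s | no _ | no _ | no _ | no _ = ≤-refl
    antitone a b (a∈ , _ , e , _) | no a∉A | no a∉B | no _ | yes b∈B =
      contradiction (inB b∈B a∈ e) [ a∉A , a∉B ]′

    level₀ : ∀ a b → Level (Mono E Y col) rank 0 a b → Mono E A cA a b
    level₀ a b s with a ∈? A | a ∈? B | b ∈? A | b ∈? B
    level₀ a b ((_ , _ , e , eq) , _) | yes a∈ | _ | yes b∈ | _ = a∈ , b∈ , e , ↑ˡ-injective l _ _ eq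
    level₀ a b (_ , () , _) | no _ | yes _ | _ | _
    level₀ a b (_ , () , _) | no _ | no _ | _ | _
    level₀ a b (_ , _ , ()) | yes _ | _ | no _ | yes _
    level₀ a b (_ , _ , ()) | yes _ | _ | no _ | no _

    level₁ : ∀ a b → Level (Mono E Y col) rank 1 a b → Mono E ((Y ∖ A) ∖ B) cW a b
    level₁ a b s with a ∈? A | a ∈? B | b ∈? A | b ∈? B
    level₁ a b ((a∈ , b∈ , e , eq) , _) | no a∉A | no a∉B | no b∉A | no b∉B =
      ∈-∖⁺ (∈-∖⁺ a∈ a∉A) a∉B , ∈-∖⁺ (∈-∖⁺ b∈ b∉A) b∉B , e , eq
    level₁ a b (_ , () , _) | yes _ | _ | _ | _
    level₁ a b (_ , () , _) | no _ | yes _ | _ | _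
    level₁ a b (_ , _ , ()) | no _ | no _ | yes _ | _
    level₁ a b (_ , _ , ()) | no _ | no _ | no _ | yes _

    level₂ : ∀ a b → Level (Mono E Y col) rank 2 a b → Mono E B cB a b
    level₂ a b s with a ∈? A | a ∈? B | b ∈? A | b ∈? B
    level₂ a b ((_ , _ , e , eq) , _) | no _ | yes a∈ | no _ | yes b∈ = a∈ , b∈ , e , ↑ʳ-injective k _ _ eq
    level₂ a b (_ , () , _) | yes _ | _ | _ | _
    level₂ a b (_ , () , _) | no _ | no _ | _ | _
    level₂ a b (_ , _ , ()) | no _ | yes _ | yes _ | _
    level₂ a b (_ , _ , ()) | no _ | yes _ | no _ | no _

    level₃ : ∀ r a b → ¬ Level (Mono E Y col) rank (suc (suc (suc r))) a b
    level₃ r a b s with a ∈? A | a ∈? B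
    level₃ r a b (_ , () , _) | yes _ | _
    level₃ r a b (_ , () , _) | no _ | yes _
    level₃ r a b (_ , () , _) | no _ | no _

    levels : ∀ r → Acyclic (Level (Mono E Y col) rank r)
    levels 0                   = acyclicA ∘ walk-map level₀
    levels 1                   = acyclicW ∘ walk-map level₁
    levels 2                   = acyclicB ∘ walk-map level₂
    levels (suc (suc (suc r))) = arcless-acyclic (level₃ r)

  colourable-∪ : ∀ {X Y} → Colourable E X k → Colourable E (Y ∖ X) (suc l) → Colourable E Y (k + suc l)
  colourable-∪ {X = X} {Y} X-col W-col = colourable-dipolar
    (λ _ b∈ _ → split b∈) (λ _ a∈ _ → split a∈) X-col W-col
    -- Nothing remains outside the two parts, but a colouring is a total function and so needs a
    -- nonempty palette; this is why the bound has the form `suc l`.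
    (subst (Colourable E _) (sym (+-suc _ _))
      (colourable-empty λ x∈ → proj₂ (∈-∖⁻ (Y ∖ X) (Y ∖ X) x∈) (proj₁ (∈-∖⁻ (Y ∖ X) (Y ∖ X) x∈))))
    where
    split : ∀ {x} → x ∈ Y → x ∈ X ⊎ x ∈ Y ∖ X
    split {x} x∈ with x ∈? X
    ... | yes x∈X = inj₁ x∈X
    ... | no  x∉X = inj₂ (∈-∖⁺ x∈ x∉X)

-- Reachability, in-closures and the forbidden configurations

module _ (E : Fin N → Fin N → Set) where

  -- Only the vertices before the target are confined to `Y`; the target itself may lie outside.
  data Reaches (T : Fin N → Set) (Y : Subset N) : Fin N → Set where
    stop : ∀ {v s} → v ∈ Y → E v s → T s → Reaches T Y v
    step : ∀ {v w} → v ∈ Y → E v w → Reaches T Y w → Reaches T Y v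

module _ {E : Fin N → Fin N → Set} where

  reaches-∈ : ∀ {T Y v} → Reaches E T Y v → v ∈ Y
  reaches-∈ (stop v∈ _ _) = v∈
  reaches-∈ (step v∈ _ _) = v∈

  reaches-⊆ : ∀ {T X Y v} → X ⊆ Y → Reaches E T X v → Reaches E T Y v
  reaches-⊆ X⊆Y (stop v∈ e t) = stop (X⊆Y v∈) e t
  reaches-⊆ X⊆Y (step v∈ e r) = step (X⊆Y v∈) e (reaches-⊆ X⊆Y r)

  reaches-target : ∀ {T Y v} → Reaches E T Y v → ∃ λ w → ∃ λ s → w ∈ Y × E w s × T s
  reaches-target (stop v∈ e t) = _ , _ , v∈ , e , t
  reaches-target (step _ _ r)  = reaches-target r

  -- A walk in `Y` that meets `Z` must have started in `Z`, because no arc enters `Z` from the rest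
  -- of `Y`.
  reaches-∖ : ∀ {T Y Z v} → (∀ {a b} → b ∈ Z → a ∈ Y → E a b → a ∈ Z) →
              Reaches E T Y v → v ∈ Z ⊎ Reaches E T (Y ∖ Z) v
  reaches-∖ {Z = Z} closed (stop {v} v∈ e t) with v ∈? Z
  ... | yes v∈Z = inj₁ v∈Z
  ... | no  v∉Z = inj₂ (stop (∈-∖⁺ v∈ v∉Z) e t)
  reaches-∖ {Z = Z} closed (step {v} v∈ e r) with v ∈? Z | reaches-∖ closed r
  ... | yes v∈Z | _         = inj₁ v∈Z
  ... | no  v∉Z | inj₁ w∈Z  = contradiction (closed w∈Z v∈ e) v∉Z
  ... | no  v∉Z | inj₂ r′   = inj₂ (step (∈-∖⁺ v∈ v∉Z) e r′)

  -- The last vertex before the target lies in `X`, so the walk can be cut at its first visit to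
  -- `X`.
  reaches-through : ∀ {T Y X v} → (∀ {a s} → a ∈ Y → E a s → T s → a ∈ X) →
                    Reaches E T Y v → v ∈ X ⊎ Reaches E (_∈ X) (Y ∖ X) v
  reaches-through targets (stop v∈ e t) = inj₁ (targets v∈ e t)
  reaches-through {X = X} targets (step {v} v∈ e r) with v ∈? X | reaches-through targets r
  ... | yes v∈X | _        = inj₁ v∈X
  ... | no  v∉X | inj₁ w∈X = inj₂ (stop (∈-∖⁺ v∈ v∉X) e w∈X)
  ... | no  v∉X | inj₂ r′  = inj₂ (step (∈-∖⁺ v∈ v∉X) e r′)

  -- The least subset of `Y` that contains the in-neighbours of `q` and is closed under
  -- in-neighbours in `Y`. Minimality is expressed by `reaches`, which supplies the reachability
  -- invariant after `q` is prepended to a path.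
  record InClosure (Y : Subset N) (q : Fin N) : Set where
    field
      carrier      : Subset N
      carrier⊆     : carrier ⊆ Y
      inNeighbours : ∀ {v} → v ∈ Y → E v q → v ∈ carrier
      closed       : ∀ {a b} → b ∈ carrier → a ∈ Y → E a b → a ∈ carrier
      reaches      : ∀ {v} → v ∈ carrier → Reaches E (_≡ q) carrier v

  in-closure : Decidable E → ∀ Y q → InClosure Y q
  in-closure E? Y q = grow ⊥ (⊃-wellFounded ⊥) (⊥-elim ∘ ∉⊥) (⊥-elim ∘ ∉⊥)
    where
    grow : ∀ Z → Acc _⊃_ Z → Z ⊆ Y → (∀ {v} → v ∈ Z → Reaches E (_≡ q) Z v) → InClosure Y q
    grow Z (acc rec) Z⊆Y r
      -- Search for a missing in-neighbour of `q` or of the current set. Each one found enlarges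
      -- `Z`, so the search ends.
      with any? (λ v → v ∈? Y ×-dec ¬? (v ∈? Z) ×-dec (E? v q ⊎-dec any? (λ w → w ∈? Z ×-dec E? v w)))
    ... | no ¬new = record
      { carrier = Z
      ; carrier⊆ = Z⊆Y
      ; inNeighbours = λ {v} v∈ e → decidable-stable (v ∈? Z) λ v∉ → ¬new (v , v∈ , v∉ , inj₁ e)
      ; closed = λ {a} b∈ a∈ e → decidable-stable (a ∈? Z) λ a∉ → ¬new (a , a∈ , a∉ , inj₂ (_ , b∈ , e))
      ; reaches = r
      }
    ... | yes (v , v∈Y , v∉Z , e) = grow Z′ (rec (Z⊆Z′ , v , v∈Z′ , v∉Z)) Z′⊆Y r′
      where
      Z′ = Z ∪ ⁅ v ⁆
      Z⊆Z′ : Z ⊆ Z′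
      Z⊆Z′ = p⊆p∪q ⁅ v ⁆
      v∈Z′ : v ∈ Z′
      v∈Z′ = q⊆p∪q Z ⁅ v ⁆ (x∈⁅x⁆ v)
      Z′⊆Y : Z′ ⊆ Y
      Z′⊆Y x∈ with x∈p∪q⁻ Z ⁅ v ⁆ x∈
      ... | inj₁ x∈Z = Z⊆Y x∈Z
      ... | inj₂ x∈v rewrite x∈⁅y⁆⇒x≡y v x∈v = v∈Y
      r-new : E v q ⊎ (∃ λ w → w ∈ Z × E v w) → Reaches E (_≡ q) Z′ v
      r-new (inj₁ e)            = stop v∈Z′ e refl
      r-new (inj₂ (w , w∈ , e)) = step v∈Z′ e (reaches-⊆ Z⊆Z′ (r w∈))
      r′ : ∀ {x} → x ∈ Z′ → Reaches E (_≡ q) Z′ x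
      r′ x∈ with x∈p∪q⁻ Z ⁅ v ⁆ x∈
      ... | inj₁ x∈Z = reaches-⊆ Z⊆Z′ (r x∈Z)
      ... | inj₂ x∈v rewrite x∈⁅y⁆⇒x≡y v x∈v = r-new e

-- Formulated for a bare relation so that it can be reversed, and with closed walks because back
-- arcs on a path yield these directly.
record PathAndShortCycleFree (E : Fin N → Fin N → Set) (t : ℕ) : Set where
  field
    arc?          : Decidable E
    irreflexive   : ∀ {v} → ¬ E v v
    asymmetric    : ∀ {u v} → E u v → ¬ E v u
    noShortWalk   : ∀ {k v} → suc k < t → ¬ Walk E v (suc k) v
    noInducedPath : (p : Vector (Fin N) t) → Consecutive E p →
                    ¬ (∀ i j → E (p i) (p j) → toℕ j ≡ suc (toℕ i))

opposite-suc : ∀ (i j : Fin k) → toℕ j ≡ suc (toℕ i) → toℕ (opposite i) ≡ suc (toℕ (opposite j))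
opposite-suc {k} i j eq = trans (opposite-prop i) (trans
  (trans (cong (k ∸_) (sym eq)) (sym (suc-∸ (toℕ<n j)))) (cong suc (sym (opposite-prop j))))
  where
  suc-∸ : ∀ {m n} → m < n → suc (n ∸ suc m) ≡ n ∸ m
  suc-∸ {zero}  (s≤s _) = refl
  suc-∸ {suc m} (s≤s m<n) = suc-∸ m<n

flip-free : ∀ {E : Fin N → Fin N → Set} {t} → PathAndShortCycleFree E t → PathAndShortCycleFree (flip E) t
flip-free free = record
  { arc? = flip arc?
  ; irreflexive = irreflexive
  ; asymmetric = asymmetric
  ; noShortWalk = λ k<t w → noShortWalk k<t (walk-reverse w)
  ; noInducedPath = λ p c ind → noInducedPath (p ∘ opposite)
      (λ i j e → c (opposite j) (opposite i) (opposite-suc i j e))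
      (λ i j e → subst₂ (λ x y → toℕ x ≡ suc (toℕ y)) (opposite-involutive j) (opposite-involutive i)
        (opposite-suc (opposite j) (opposite i) (ind (opposite j) (opposite i) e)))
  }
  where open PathAndShortCycleFree free

-- Growing a path at its front

pathBound : ℕ → ℕ → ℕ
-- `r` counts the vertices to prepend until the path has `t - 1` of them. Each costs `c` colours,
-- for the in-neighbours of the head, so the value is `r * c + 1`.
pathBound c zero    = 1
pathBound c (suc r) = c + pathBound c r

pathBound-suc : ∀ c r → ∃ λ b → pathBound c r ≡ suc b
pathBound-suc c zero = 0 , refl
pathBound-suc c (suc r) with pathBound-suc c r
... | b , eq = c + b , trans (cong (c +_) eq) (+-suc c b)

module _ {E : Fin N → Fin N → Set} {t : ℕ} (free : PathAndShortCycleFree E t) (A : Subset N) (c : ℕ)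
         (locally : ∀ {v X} → v ∈ A → X ⊆ A → (∀ {x} → x ∈ X → E x v) → Colourable E X c) where
  open PathAndShortCycleFree free

  -- Of the possible backward arcs only those too long to close a short walk matter, and `fromLast`
  -- is kept for that case. `toTail` is what preserves `noShortcut` when a vertex of `Q` is
  -- prepended.
  record Extendable {m : ℕ} (p : Vector (Fin N) (suc m)) (Q : Subset N) : Set where
    field
      consecutive : Consecutive E p
      noShortcut  : ∀ i j → toℕ i < toℕ j → E (p i) (p j) → toℕ j ≡ suc (toℕ i)
      head∈       : p zero ∈ A
      Q⊆          : Q ⊆ A
      fromLast    : ∀ {x} → x ∈ Q → ¬ E (p (fromℕ m)) x
      toTail      : ∀ {x} → x ∈ Q → ∀ j → ¬ E x (p (suc j))
      reachesHead : ∀ {x} → x ∈ Q → Reaches E (_≡ p zero) Q x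

  module _ {m} {p : Vector (Fin N) (suc m)} {Q} (ext : Extendable p Q) where
    open Extendable ext

    module _ {q} (q∈ : q ∈ Q) (q→p₀ : E q (p zero)) where

      ∷-consecutive : Consecutive E (q ∷ p)
      ∷-consecutive zero    (suc zero) _ = q→p₀
      ∷-consecutive (suc i) (suc j) eq   = consecutive i j (suc-injective eq)

      ∷-noShortcut : ∀ i j → toℕ i < toℕ j → E ((q ∷ p) i) ((q ∷ p) j) → toℕ j ≡ suc (toℕ i)
      ∷-noShortcut zero    (suc zero)    _         _ = refl
      ∷-noShortcut zero    (suc (suc j)) _         e = contradiction e (toTail q∈ j)
      ∷-noShortcut (suc i) (suc j)       (s≤s i<j) e = cong suc (noShortcut i j i<j e)

    noExtension : t ≡ suc (suc m) → ∀ {x} → x ∉ Q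
    noExtension refl x∈ with reaches-target (reachesHead x∈)
    ... | q , _ , q∈ , q→p₀ , refl = noInducedPath (q ∷ p) (∷-consecutive q∈ q→p₀) induced
      where
      noBackArc : ∀ i j → toℕ j ≤ toℕ i → ¬ E ((q ∷ p) i) ((q ∷ p) j)
      noBackArc zero    zero    _   e = irreflexive e
      noBackArc (suc i) (suc j) j≤i e =
        -- The back arc and the path segment it spans form a closed walk with at most
        -- `m + 1 = t - 1` arcs.
        noShortWalk (s≤s (s≤s (≤-trans (m∸n≤m (toℕ i) (toℕ j)) (≤-pred (toℕ<n i)))))
          (e ◅ segment (q ∷ p) (∷-consecutive q∈ q→p₀) (suc j) (suc i) j≤i)
      noBackArc (suc i) zero    _   e with <-cmp (toℕ i) m
      ... | tri< i<m _ _ =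
        noShortWalk (s≤s (s≤s i<m)) (e ◅ segment (q ∷ p) (∷-consecutive q∈ q→p₀) zero (suc i) z≤n)
      ... | tri> _ _ m<i = contradiction (toℕ<n i) λ i<1+m → 1+n≰n (≤-trans m<i (≤-pred i<1+m))
      -- The arc from the last vertex to `q` would close a walk with exactly `t` arcs, which
      -- `noShortWalk` permits.
      ... | tri≈ _ i≡m _ = fromLast q∈
        (subst (λ i → E (p i) q) (toℕ-injective (trans i≡m (sym (toℕ-fromℕ m)))) e)
      induced : ∀ i j → E ((q ∷ p) i) ((q ∷ p) j) → toℕ j ≡ suc (toℕ i)
      induced i j e with <-cmp (toℕ i) (toℕ j)
      ... | tri< i<j _ _ = ∷-noShortcut q∈ q→p₀ i j i<j e
      ... | tri≈ _ i≡j _ = contradiction e (noBackArc i j (≤-reflexive (sym i≡j)))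
      ... | tri> _ _ j<i = contradiction e (noBackArc i j (<⇒≤ j<i))

  -- The in-neighbours `N₁` of the head get `c` fresh colours. The rest of `Q` is split into
  -- in-closures of vertices `q` of `N₁`, each coloured by induction along `q ∷ p`. All of them
  -- share one palette, as no arc enters an in-closure from what is left after it.
  extendable-colourable : ∀ r {m} {p : Vector (Fin N) (suc m)} {Q} → t ≡ r + suc (suc m) →
                          Extendable p Q → Colourable E Q (pathBound c r)
  extendable-colourable zero eq ext =
    colourable-empty (noExtension ext eq)
  extendable-colourable (suc r) {m} {p} {Q} eq ext with pathBound-suc c r
  ... | b , bound≡ = subst (λ l → Colourable E Q (c + l)) (sym bound≡)
        (colourable-∪ (locally head∈ (Q⊆ ∘ proj₁ ∘ N⁻) (proj₂ ∘ N⁻)) (subst (Colourable E _) bound≡ rest))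
    where
    open Extendable ext
    N? = λ x → x ∈? Q ×-dec arc? x (p zero)
    N₁ = comprehension N?
    N⁻ = ∈-comprehension⁻ N?

    peel : ∀ Y → Acc _⊂_ Y → Y ⊆ Q ∖ N₁ → (∀ {v} → v ∈ Y → Reaches E (_∈ N₁) Y v) →
           Colourable E Y (pathBound c r)
    peel Y (acc rec) Y⊆ reaches-N with nonempty? Y
    ... | no ¬y = subst (Colourable E Y) (sym (proj₂ (pathBound-suc c r))) (colourable-empty λ x∈ → ¬y (_ , x∈))
    ... | yes (v , v∈) with reaches-target (reaches-N v∈)
    ... | y , q , y∈ , y→q , q∈N = colourable-∖-closed closed
            (extendable-colourable r (trans eq (sym (+-suc r _))) ext′)
            -- `y` is an in-neighbour of `q` in `Y`, hence in the carrier, so `Y` really shrinks.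
            (peel (Y ∖ carrier) (rec (∖-⊂ y∈ (inNeighbours y∈ y→q))) (Y⊆ ∘ proj₁ ∘ ∈-∖⁻ Y carrier) reaches′)
      where
      open InClosure (in-closure {E = E} arc? Y q)
      carrier⊆Q : carrier ⊆ Q
      carrier⊆Q x∈ = proj₁ (∈-∖⁻ Q N₁ (Y⊆ (carrier⊆ x∈)))
      ext′ : Extendable (q ∷ p) carrier
      ext′ = record
        { consecutive = ∷-consecutive ext (proj₁ (N⁻ q∈N)) (proj₂ (N⁻ q∈N))
        ; noShortcut = ∷-noShortcut ext (proj₁ (N⁻ q∈N)) (proj₂ (N⁻ q∈N))
        ; head∈ = Q⊆ (proj₁ (N⁻ q∈N))
        ; Q⊆ = Q⊆ ∘ carrier⊆Q
        ; fromLast = fromLast ∘ carrier⊆Q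
        ; toTail = λ where
            -- The old head is now in the tail, and its in-neighbours in `Q` were removed with `N₁`.
            x∈ zero e → proj₂ (∈-∖⁻ Q N₁ (Y⊆ (carrier⊆ x∈))) (∈-comprehension⁺ N? (carrier⊆Q x∈ , e))
            x∈ (suc j) → toTail (carrier⊆Q x∈) j
        ; reachesHead = reaches
        }
      reaches′ : ∀ {v} → v ∈ Y ∖ carrier → Reaches E (_∈ N₁) (Y ∖ carrier) v
      reaches′ v∈ with reaches-∖ closed (reaches-N (proj₁ (∈-∖⁻ Y carrier v∈)))
      ... | inj₁ v∈C = contradiction v∈C (proj₂ (∈-∖⁻ Y carrier v∈))
      ... | inj₂ r   = r

    reaches-rest : ∀ {v} → v ∈ Q ∖ N₁ → Reaches E (_∈ N₁) (Q ∖ N₁) v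
    reaches-rest v∈ with reaches-through (λ { a∈ e refl → ∈-comprehension⁺ N? (a∈ , e) })
                           (reachesHead (proj₁ (∈-∖⁻ Q N₁ v∈)))
    ... | inj₁ v∈N = contradiction v∈N (proj₂ (∈-∖⁻ Q N₁ v∈))
    ... | inj₂ r   = r

    rest : Colourable E (Q ∖ N₁) (pathBound c r)
    rest = peel (Q ∖ N₁) (⊂-wellFounded _) id reaches-rest

-- Cliques and the induction on the clique number

CliqueIn : (Fin N → Fin N → Set) → Subset N → ℕ → Set
CliqueIn {N} E Y k = Σ[ c ∈ Vector (Fin N) k ] (∀ i → c i ∈ Y) × (∀ i j → i ≢ j → E (c i) (c j) ⊎ E (c j) (c i))

clique-∷ : ∀ {E : Fin N → Fin N → Set} {Y X v} → v ∈ Y → X ⊆ Y → (∀ {x} → x ∈ X → E x v ⊎ E v x) →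
           CliqueIn E X k → CliqueIn E Y (suc k)
clique-∷ {v = v} v∈ X⊆Y adjacent (c , c∈ , adj) = v ∷ c , ∷-∈ , ∷-adj
  where
  ∷-∈ : ∀ i → (v ∷ c) i ∈ _
  ∷-∈ zero    = v∈
  ∷-∈ (suc i) = X⊆Y (c∈ i)
  ∷-adj : ∀ i j → i ≢ j → _ ⊎ _
  ∷-adj zero    zero    i≢j = contradiction refl i≢j
  ∷-adj zero    (suc j) _   = swap (adjacent (c∈ j))
  ∷-adj (suc i) zero    _   = adjacent (c∈ i)
  ∷-adj (suc i) (suc j) i≢j = adj i j (i≢j ∘ cong suc)

-- The summands are the palettes of `Q⁺`, of `u` and of `Q⁻`. Here `r` is `t - 2`, as the path
-- starts as the single vertex `u`. With `f` for the bound, `f (w + 1) = 2 * r * f w + 3`.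
dichromaticBound : ℕ → ℕ → ℕ
dichromaticBound r zero    = 1
dichromaticBound r (suc w) = pathBound (dichromaticBound r w) r + 1 + pathBound (dichromaticBound r w) r

module _ {E : Fin N → Fin N → Set} {t} (free : PathAndShortCycleFree E t) where
  open PathAndShortCycleFree free

  avoiding : Subset N → Fin N → Subset N
  avoiding Y u = comprehension (λ v → v ∈? Y ×-dec ¬? (v ≟ u) ×-dec ¬? (arc? u v))

  ∈-avoiding⁺ : ∀ {Y u v} → v ∈ Y → v ≢ u → ¬ E u v → v ∈ avoiding Y u
  ∈-avoiding⁺ {Y} {u} v∈ v≢u ¬e =
    ∈-comprehension⁺ (λ v → v ∈? Y ×-dec ¬? (v ≟ u) ×-dec ¬? (arc? u v)) (v∈ , v≢u , ¬e)

  ∈-avoiding⁻ : ∀ {Y u v} → v ∈ avoiding Y u → v ∈ Y × v ≢ u × ¬ E u v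
  ∈-avoiding⁻ {Y} {u} = ∈-comprehension⁻ (λ v → v ∈? Y ×-dec ¬? (v ≟ u) ×-dec ¬? (arc? u v))

  side : ∀ Y u → InClosure {E = E} (avoiding Y u) u
  side Y u = in-closure arc? (avoiding Y u) u

  -- By asymmetry an in-neighbour of `u` is not an out-neighbour, so it survives in `avoiding Y u`.
  side-inNeighbours : ∀ {Y u v} → v ∈ Y → E v u → v ∈ InClosure.carrier (side Y u)
  side-inNeighbours v∈ e = InClosure.inNeighbours (side _ _)
    (∈-avoiding⁺ v∈ (λ { refl → irreflexive e }) (asymmetric e)) e

  side-colourable : ∀ {r c A Y u} → t ≡ r + 2 →
    (∀ {v X} → v ∈ A → X ⊆ A → (∀ {x} → x ∈ X → E x v) → Colourable E X c) →
    u ∈ A → Y ⊆ A → Colourable E (InClosure.carrier (side Y u)) (pathBound c r)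
  side-colourable {r} {c} {A} {Y} {u} eq locally u∈ Y⊆A =
    extendable-colourable free A c locally r {p = λ _ → u} eq record
      { consecutive = λ { zero zero () }
      ; noShortcut = λ { zero zero () }
      ; head∈ = u∈
      ; Q⊆ = Y⊆A ∘ proj₁ ∘ ∈-avoiding⁻ ∘ carrier⊆
      -- This is why the out-neighbours of `u` are avoided: `u` remains the last vertex however far
      -- the path grows.
      ; fromLast = proj₂ ∘ proj₂ ∘ ∈-avoiding⁻ ∘ carrier⊆
      ; toTail = λ _ ()
      ; reachesHead = reaches
      }
    where open InClosure (side Y u)

module _ {E : Fin N → Fin N → Set} {t r} (free : PathAndShortCycleFree E t) (t≡ : t ≡ r + 2) where
  open PathAndShortCycleFree free

  -- Outer induction on `w`: a vertex extends every clique among its neighbours, so neighbourhoods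
  -- satisfy the bound for a smaller `w`. The inner induction `peel` removes `u` and its two sides
  -- from `Y`.
  cliqueFree-colourable : ∀ w Y → ¬ CliqueIn E Y (suc w) → Colourable E Y (dichromaticBound r w)
  cliqueFree-colourable zero Y ¬clique =
    colourable-empty λ {x} x∈ → ¬clique ((λ _ → x) , (λ _ → x∈) , λ { zero zero 0≢0 → contradiction refl 0≢0 })
  cliqueFree-colourable (suc w) A ¬clique = peel A (⊂-wellFounded A) id
    where
    c = dichromaticBound r w

    locally : ∀ {v X} → v ∈ A → X ⊆ A → (∀ {x} → x ∈ X → E x v ⊎ E v x) → Colourable E X c
    locally v∈ X⊆ adjacent = cliqueFree-colourable w _ (¬clique ∘ clique-∷ v∈ X⊆ adjacent)

    peel : ∀ Y → Acc _⊂_ Y → Y ⊆ A → Colourable E Y (dichromaticBound r (suc w))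
    peel Y (acc rec) Y⊆A with nonempty? Y
    ... | no ¬y = subst (Colourable E Y) (sym positive) (colourable-empty λ x∈ → ¬y (_ , x∈))
      where
      positive : dichromaticBound r (suc w) ≡ suc (pathBound c r + pathBound c r)
      positive = cong (_+ pathBound c r) (+-comm (pathBound c r) 1)
    ... | yes (u , u∈) = colourable-dipolar outS⁺ inS⁻ S⁺-col S⁻-col
            (peel W (rec (W⊆ , u , u∈ , u∉W)) (Y⊆A ∘ W⊆))
      where
      module In  = InClosure (side free Y u)
      module Out = InClosure (side (flip-free free) Y u)
      Q⁻ = In.carrier
      Q⁺ = Out.carrier
      S⁺ = Q⁺ ∪ ⁅ u ⁆
      W  = (Y ∖ S⁺) ∖ Q⁻

      u∈S⁺ : u ∈ S⁺
      u∈S⁺ = q⊆p∪q Q⁺ ⁅ u ⁆ (x∈⁅x⁆ u)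
      Q⁺⊆S⁺ : Q⁺ ⊆ S⁺
      Q⁺⊆S⁺ = p⊆p∪q ⁅ u ⁆
      W⊆ : W ⊆ Y
      W⊆ = proj₁ ∘ ∈-∖⁻ Y S⁺ ∘ proj₁ ∘ ∈-∖⁻ (Y ∖ S⁺) Q⁻
      u∉W : u ∉ W
      u∉W u∈W = proj₂ (∈-∖⁻ Y S⁺ (proj₁ (∈-∖⁻ (Y ∖ S⁺) Q⁻ u∈W))) u∈S⁺

      -- An arc can leave `Q⁺` only to `u` or to an in-neighbour of `u`, and the latter belongs to
      -- `Q⁻`. The out-neighbours of `u` are in `Q⁺`.
      outS⁺ : ∀ {a b} → a ∈ S⁺ → b ∈ Y → E a b → b ∈ S⁺ ⊎ b ∈ Q⁻
      outS⁺ {a} {b} a∈ b∈ e with x∈p∪q⁻ Q⁺ ⁅ u ⁆ a∈ | b ≟ u | arc? b u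
      ... | _        | yes refl | _      = inj₁ u∈S⁺
      ... | _        | no _     | yes b→u = inj₂ (side-inNeighbours free b∈ b→u)
      ... | inj₁ a∈Q | no b≢u   | no ¬b→u =
        inj₁ (Q⁺⊆S⁺ (Out.closed a∈Q (∈-avoiding⁺ (flip-free free) b∈ b≢u ¬b→u) e))
      ... | inj₂ a∈u | no _     | no _ rewrite x∈⁅y⁆⇒x≡y u a∈u =
        inj₁ (Q⁺⊆S⁺ (side-inNeighbours (flip-free free) b∈ e))

      inS⁻ : ∀ {a b} → b ∈ Q⁻ → a ∈ Y → E a b → a ∈ S⁺ ⊎ a ∈ Q⁻
      inS⁻ {a} {b} b∈ a∈ e with a ≟ u | arc? u a
      ... | yes refl | _       = inj₁ u∈S⁺
      ... | no _     | yes u→a = inj₁ (Q⁺⊆S⁺ (side-inNeighbours (flip-free free) a∈ u→a))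
      ... | no a≢u   | no ¬u→a = inj₂ (In.closed b∈ (∈-avoiding⁺ free a∈ a≢u ¬u→a) e)

      S⁻-col : Colourable E Q⁻ (pathBound c r)
      S⁻-col = side-colourable free t≡ (λ v∈ X⊆ adj → locally v∈ X⊆ (inj₁ ∘ adj)) (Y⊆A u∈) Y⊆A

      Q⁺-col : Colourable E Q⁺ (pathBound c r)
      -- Out-neighbourhoods become in-neighbourhoods once all arcs are reversed.
      Q⁺-col = colourable-flip (side-colourable (flip-free free) t≡
        (λ v∈ X⊆ adj → colourable-flip (locally v∈ X⊆ (inj₂ ∘ adj))) (Y⊆A u∈) Y⊆A)

      only-u : ∀ {x} → x ∈ S⁺ ∖ Q⁺ → x ≡ u
      only-u x∈ with ∈-∖⁻ S⁺ Q⁺ x∈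
      ... | x∈S , x∉Q with x∈p∪q⁻ Q⁺ ⁅ u ⁆ x∈S
      ... | inj₁ x∈Q = contradiction x∈Q x∉Q
      ... | inj₂ x∈u = x∈⁅y⁆⇒x≡y u x∈u

      S⁺-col : Colourable E S⁺ (pathBound c r + 1)
      S⁺-col = colourable-∪ Q⁺-col ((λ _ → zero) , arcless-acyclic λ a b (a∈ , b∈ , e , _) →
        irreflexive (subst₂ E (only-u a∈) (only-u b∈) e))

-- Closed walks and induced cycles in digraphs

next-suc : ∀ {m} (i j : Fin (suc m)) → toℕ j ≡ suc (toℕ i) → next i ≡ j
next-suc {m} i j eq = toℕ-injective (trans (toℕ-fromℕ< _)
  (trans (m<n⇒m%n≡m (subst (_< suc m) eq (toℕ<n j))) (sym eq)))

next-last : ∀ m → next (fromℕ m) ≡ zero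
next-last m = toℕ-injective (trans (toℕ-fromℕ< _)
  (trans (cong (λ x → suc x % suc m) (toℕ-fromℕ m)) (n%n≡0 (suc m))))

-- Starting at the last vertex puts the wrap-around arc first and leaves a single segment.
cycle-walk : ∀ {R : A → A → Set} {m} (p : Vector A (suc m)) → (∀ i → R (p i) (p (next i))) →
             Walk R (p (fromℕ m)) (suc m) (p (fromℕ m))
cycle-walk {R = R} {m} p arcs =
  subst (R (p (fromℕ m)) ∘ p) (next-last m) (arcs (fromℕ m))
  ◅ subst (λ l → Walk R (p zero) l (p (fromℕ m))) (toℕ-fromℕ m)
      (segment p (λ i j eq → subst (R (p i) ∘ p) (next-suc i j eq) (arcs i)) zero (fromℕ m) z≤n)

module _ (D : Digraph) where

  Arc : Fin (n D) → Fin (n D) → Set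
  Arc u v = arc D u v ≡ true

  arc-irreflexive : ∀ {v} → ¬ Arc v v
  arc-irreflexive {v} e with trans (sym e) (loopless D v)
  ... | ()

  arc-asymmetric : ∀ {u v} → Arc u v → ¬ Arc v u
  arc-asymmetric {u} {v} e e′ with trans (sym e′) (asym D u v e)
  ... | ()

  -- A repeated vertex or a chord would give a closed walk with fewer arcs, so the vertices of `w`
  -- form an induced cycle.
  module ShortestClosedWalk {k} (noShorter : ∀ {l v} → l < k → ¬ Walk Arc v (suc l) v)
                            {v} (w : Walk Arc v (suc k) v) where

    p : Vector (Fin (n D)) (suc k)
    p = sources w

    consecutive : Consecutive Arc p
    consecutive = sources-consecutive w

    lastArc : Arc (p (fromℕ k)) (p zero)
    lastArc = subst (Arc (p (fromℕ k))) (sources-zero w) (sources-last w)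
      where
      sources-zero : ∀ {b} (w : Walk Arc v (suc k) b) → v ≡ sources w zero
      sources-zero (_ ◅ _) = refl

    noShort : ∀ {l v} → 0 < l → l ≤ k → ¬ Walk Arc v l v
    noShort {suc l} _ l<k = noShorter l<k

    toℕ≤k : (i : Fin (suc k)) → toℕ i ≤ k
    toℕ≤k i = ≤-pred (toℕ<n i)

    noRepetition : ∀ i j → toℕ i < toℕ j → p i ≢ p j
    noRepetition i j i<j eq = noShort (m<n⇒0<n∸m i<j) (≤-trans (m∸n≤m (toℕ j) (toℕ i)) (toℕ≤k j))
      (subst (Walk Arc (p i) _) (sym eq) (segment p consecutive i j (<⇒≤ i<j)))

    p-injective : ∀ {i j} → p i ≡ p j → i ≡ j
    p-injective {i} {j} eq with <-cmp (toℕ i) (toℕ j)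
    ... | tri< i<j _ _ = contradiction eq (noRepetition i j i<j)
    ... | tri≈ _ i≡j _ = toℕ-injective i≡j
    ... | tri> _ _ j<i = contradiction (sym eq) (noRepetition j i j<i)

    noForwardChord : ∀ i j → suc (toℕ i) < toℕ j → ¬ Arc (p i) (p j)
    noForwardChord i j 1+i<j e = noShort (s≤s z≤n) short
      -- Follow the chord, go on to the last vertex, close up and return to `p i`; the part strictly
      -- between `i` and `j` is skipped.
      (e ◅ segment p consecutive j (fromℕ k) (subst (toℕ j ≤_) (sym (toℕ-fromℕ k)) (toℕ≤k j))
         ◅◅ lastArc ◅ segment p consecutive zero i z≤n)
      where
      short : suc ((toℕ (fromℕ k) ∸ toℕ j) + suc (toℕ i)) ≤ k
      short rewrite toℕ-fromℕ k | sym (+-suc (k ∸ toℕ j) (suc (toℕ i))) =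
        ≤-trans (+-monoʳ-≤ (k ∸ toℕ j) 1+i<j) (≤-reflexive (m∸n+n≡m (toℕ≤k j)))

    backArc : ∀ i j → toℕ j ≤ toℕ i → Arc (p i) (p j) → j ≡ next i
    backArc (suc i) (suc j) j≤i e = contradiction (e ◅ segment p consecutive (suc j) (suc i) j≤i)
      (noShort (s≤s z≤n) (≤-trans (s≤s (m∸n≤m (toℕ i) (toℕ j))) (toℕ≤k (suc i))))
    backArc i zero j≤i e with <-cmp (toℕ i) k
    ... | tri< i<k _ _ = contradiction (e ◅ segment p consecutive zero i z≤n) (noShort (s≤s z≤n) i<k)
    -- From the last vertex to the first, the arc is the closing one and no chord.
    ... | tri≈ _ i≡k _ = trans (sym (next-last k))
            (cong next (toℕ-injective (trans (toℕ-fromℕ k) (sym i≡k))))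
    ... | tri> _ _ k<i = contradiction (≤-trans k<i (toℕ≤k i)) 1+n≰n

    p-induced : ∀ i j → Arc (p i) (p j) → j ≡ next i
    p-induced i j e with <-cmp (suc (toℕ i)) (toℕ j)
    ... | tri< 1+i<j _ _ = contradiction e (noForwardChord i j 1+i<j)
    ... | tri≈ _ 1+i≡j _ = sym (next-suc i j (sym 1+i≡j))
    ... | tri> _ _ j<1+i = backArc i j (≤-pred j<1+i) e

    p-cycle : 1 ≤ k → DirectedCycle D k
    p-cycle 1≤k = record { vtx = p ; len≥2 = 1≤k ; distinct = p-injective ; arcs = nextArc }
      where
      nextArc : ∀ i → Arc (p i) (p (next i))
      nextArc i with <-cmp (toℕ i) k
      ... | tri< i<k _ _ = subst (Arc (p i) ∘ p) (sym (next-suc i (fromℕ< (s≤s i<k)) (toℕ-fromℕ< (s≤s i<k))))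
              (consecutive i (fromℕ< (s≤s i<k)) (toℕ-fromℕ< (s≤s i<k)))
      ... | tri≈ _ i≡k _ rewrite toℕ-injective (trans i≡k (sym (toℕ-fromℕ k))) =
              subst (Arc (p (fromℕ k)) ∘ p) (sym (next-last k)) lastArc
      ... | tri> _ _ k<i = contradiction (≤-trans k<i (toℕ≤k i)) 1+n≰n

  -- A shortest closed walk is a loop or traces an induced cycle, whose length must be `t`. The
  -- bound `b` lets this cover both walks shorter than `t` and, if `t` is no cycle length, all
  -- walks.
  noClosedWalk : ∀ {t} → TChordal t D → ∀ b → (∀ m → 1 ≤ m → m < b → ℤ.+ suc m ≢ t) →
                 ∀ {k v} → k < b → ¬ Walk Arc v (suc k) v
  noClosedWalk {t} chordal b ≢t {k} k<b w =
    <-rec (λ k → k < b → ∀ {v} → ¬ Walk Arc v (suc k) v) minimal k k<b w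
    where
    minimal : ∀ k → (∀ {l} → l < k → l < b → ∀ {v} → ¬ Walk Arc v (suc l) v) →
              k < b → ∀ {v} → ¬ Walk Arc v (suc k) v
    minimal zero    rec k<b (e ◅ ε) = arc-irreflexive e
    minimal (suc k) rec k<b w       = ≢t (suc k) (s≤s z≤n) k<b (chordal (suc k) (p-cycle (s≤s z≤n)) p-induced)
      where open ShortestClosedWalk (λ l<k → rec l<k (≤-trans l<k (<⇒≤ k<b))) w

  pathAndShortCycleFree : ∀ {r} → TChordal (ℤ.+ (r + 2)) D → ¬ HasInducedPath (ℤ.+ (r + 2)) D →
    PathAndShortCycleFree Arc (r + 2)
  pathAndShortCycleFree {r} chordal ¬path = record
    { arc? = λ u v → arc D u v Bool.≟ true
    ; irreflexive = arc-irreflexive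
    ; asymmetric = arc-asymmetric
    ; noShortWalk = λ {k} k<t → noClosedWalk chordal (suc k)
        (λ m _ m<1+k m≡t → <-irrefl (ℤ.+-injective m≡t) (≤-<-trans m<1+k k<t)) ≤-refl
    ; noInducedPath = λ p c ind → ¬path (r + 2 , refl , record
        { pv = p ; distinct = λ {i} {j} → injective p c ind i j ; arcs = c ; induced = ind })
    }
    where
    -- If `p i` and `p j` agree, the arc from `p i` to its successor also starts at `p j`, and
    -- inducedness forces `i` and `j` to be equal.
    noRepetition : (p : Vector (Fin (n D)) (r + 2)) → Consecutive Arc p →
      (∀ i j → Arc (p i) (p j) → toℕ j ≡ suc (toℕ i)) → ∀ i j → toℕ i < toℕ j → p i ≢ p j
    noRepetition p c ind i j i<j eq = <-irrefl (suc-injective (trans (sym i⁺≡) (ind j i⁺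
        (subst (λ x → Arc x (p i⁺)) eq (c i i⁺ i⁺≡))))) i<j
      where
      i⁺ = fromℕ< (≤-<-trans i<j (toℕ<n j))
      i⁺≡ : toℕ i⁺ ≡ suc (toℕ i)
      i⁺≡ = toℕ-fromℕ< _
    injective : (p : Vector (Fin (n D)) (r + 2)) → Consecutive Arc p →
      (∀ i j → Arc (p i) (p j) → toℕ j ≡ suc (toℕ i)) → ∀ i j → p i ≡ p j → i ≡ j
    injective p c ind i j eq with <-cmp (toℕ i) (toℕ j)
    ... | tri< i<j _ _ = contradiction eq (noRepetition p c ind i j i<j)
    ... | tri≈ _ i≡j _ = toℕ-injective i≡j
    ... | tri> _ _ j<i = contradiction (sym eq) (noRepetition p c ind j i j<i)

  colourable⇒dicolorable : Colourable Arc ⊤ k → Dicolorable D k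
  colourable⇒dicolorable (col , acyclic) = col , λ a m C same → acyclic
    (cycle-walk (vtx C) λ i → ∈⊤ , ∈⊤ , arcs C i , trans (same i) (sym (same (next i))))

  noCycle-dicolorable : ∀ {t} → TChordal t D → (∀ m → 1 ≤ m → ℤ.+ suc m ≢ t) → Dicolorable D 1
  noCycle-dicolorable chordal ≢t = colourable⇒dicolorable ((λ _ → zero) ,
    λ {_} {k} w → noClosedWalk chordal (suc k) (λ m 1≤m _ → ≢t m 1≤m) ≤-refl
      (walk-map (λ _ _ (_ , _ , e , _) → e) w))

  noLargeClique : ∀ {w} → CliqueNumber D w → ¬ CliqueIn Arc ⊤ (suc w)
  noLargeClique {w} (_ , maximal) (c , _ , adj) = 1+n≰n (maximal (suc w) (c , injective , adj))
    where
    injective : ∀ {i j} → c i ≡ c j → i ≡ j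
    injective {i} {j} eq = decidable-stable (i ≟ j) λ i≢j →
      -- Equal entries at different indices would be adjacent, which gives a loop.
      [ arc-irreflexive ∘ subst (Arc (c i)) (sym eq) , arc-irreflexive ∘ subst (Arc (c j)) eq ]′ (adj i j i≢j)

theorem1p2 : (t : ℤ) → Σ (ℕ → ℕ) λ f →
    ∀ (D : Digraph) → TChordal t D → ¬ HasInducedPath t D →
    ∀ (w : ℕ) → CliqueNumber D w → Dicolorable D (f w)
theorem1p2 (ℤ.+ suc (suc r)) rewrite +-comm 2 r = dichromaticBound r , λ D chordal ¬path w ω≡w →
  colourable⇒dicolorable D (cliqueFree-colourable (pathAndShortCycleFree D chordal ¬path) refl w ⊤ (noLargeClique D ω≡w))
-- For `t` below 2 no directed cycle has length `t`, so the digraph is acyclic and one colour is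
-- enough.
theorem1p2 (ℤ.+ 1) = (λ _ → 1) , λ D chordal _ _ _ → noCycle-dicolorable D chordal λ { (suc _) _ () }
theorem1p2 (ℤ.+ 0) = (λ _ → 1) , λ D chordal _ _ _ → noCycle-dicolorable D chordal λ _ _ ()
theorem1p2 -[1+ _ ] = (λ _ → 1) , λ D chordal _ _ _ → noCycle-dicolorable D chordal λ _ _ ()
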